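{- Let $(R_1,\mathcal L_1)$ and $(R_2,\mathcal L_2)$ be recursive rings with a recursive interpretation of a language. Suppose that MRDP holds in $(R_1,\mathcal L_1)$. Let $d:R_1\to R_2$ be a Diophantine map. Then $d$ is r.e. preserving.
   Context: A recursive ring is a ring $R$ with a fixed recursive representation, i.e. an injection $j:R\to\mathbb N$ with recursive image for which addition and multiplication are recursive; subsets of $R^k$ are recursive / recursively enumerable if their images under $j^k$ are. A language $\mathcal L$ (constants, functions, relations; always containing a constant $0$ and equality) has a recursive interpretation in $R$ if all its functions are interpreted by recursive functions and all its relations by recursive sets. Terms are built from constants and variables using functions of $\mathcal L$; basic formulas are $(t_1,\ldots,t_k)\in R'$ with $R'\in\mathcal L$ a $k$-ary relation (possibly equality). $S\subset R^k$ is Diophantine if $S=\{\vec x\in R^k\mid\exists\vec y\in R^l\ (f_1\wedge\cdots\wedge f_r)\}$ for some basic formulas $f_i$. $d:R_1\to R_2$ is a Diophantine map if the coordinatewise image $d(S)\subset R_2^k$ is Diophantine for all $k$ and all Diophantine $S\subset R_1^k$. MRDP holds in $(R,\mathcal L)$ if every recursively enumerable $S\subset R$ is Diophantine in $(R,\mathcal L)$. $f:R_1\to R_2$ is r.e. preserving if $f(S)\subset R_2$ is recursively enumerable for all recursively enumerable $S\subset R_1$. -}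

module Defs where

open import Algebra.Bundles using (Ring)
open import Data.Fin.Base using (Fin)
open import Data.List.Base using (List)
open import Data.List.Relation.Unary.All using (All)
open import Data.Nat.Base using (ℕ; zero; suc; _+_; _<_)
open import Data.Product.Base using (Σ-syntax; ∃-syntax; _×_; _,_)
open import Data.Sum.Base using (_⊎_)
open import Data.Unit.Base using (⊤; tt)
open import Data.Vec.Base using (Vec; []; _∷_; map; lookup; _++_)
open import Data.Vec.Relation.Binary.Pointwise.Inductive using (Pointwise)
import Data.Vec.Relation.Binary.Pointwise.Inductive as Pw
open import Function.Bundles using (Func; Injection; _⇔_)
open import Level using (0ℓ)
open import Relation.Binary.Bundles using (Setoid)
open import Relation.Binary.PropositionalEquality.Core using (_≡_)
open import Relation.Binary.PropositionalEquality.Properties using (setoid)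
open import Relation.Nullary.Negation.Core using (¬_)
open import Relation.Unary using (Pred; _∈_)

------------------------------------------------------------------------
-- Computability on ℕ

-- Kleene's partial recursive functions, with a relational semantics:
-- f [ ns ]⇓ m means that f is defined at ns, with value m.

data Partial : ℕ → Set where
  zeroᶠ : ∀ {k} → Partial k
  sucᶠ  : Partial 1
  projᶠ : ∀ {k} → Fin k → Partial k
  compᶠ : ∀ {k m} → Partial m → Vec (Partial k) m → Partial k
  precᶠ : ∀ {k} → Partial k → Partial (2 + k) → Partial (1 + k)
  minᶠ  : ∀ {k} → Partial (1 + k) → Partial k

infix 4 _[_]⇓_

data _[_]⇓_ : ∀ {k} → Partial k → Vec ℕ k → ℕ → Set where
  zero⇓ : ∀ {k} {ns : Vec ℕ k} → zeroᶠ [ ns ]⇓ 0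
  suc⇓  : ∀ {n} → sucᶠ [ n ∷ [] ]⇓ suc n
  proj⇓ : ∀ {k} {i : Fin k} {ns} → projᶠ i [ ns ]⇓ lookup ns i
  comp⇓ : ∀ {k m} {f : Partial m} {gs : Vec (Partial k) m} {ns ms r} →
          Pointwise (λ g v → g [ ns ]⇓ v) gs ms →
          f [ ms ]⇓ r →
          compᶠ f gs [ ns ]⇓ r
  precZ⇓ : ∀ {k} {f : Partial k} {g : Partial (2 + k)} {ns r} →
           f [ ns ]⇓ r →
           precᶠ f g [ 0 ∷ ns ]⇓ r
  precS⇓ : ∀ {k} {f : Partial k} {g : Partial (2 + k)} {n ns q r} →
           precᶠ f g [ n ∷ ns ]⇓ q →
           g [ n ∷ q ∷ ns ]⇓ r →
           precᶠ f g [ suc n ∷ ns ]⇓ r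
  min⇓  : ∀ {k} {f : Partial (1 + k)} {ns n} →
          (∀ m → m < n → ∃[ q ] f [ m ∷ ns ]⇓ suc q) →
          f [ n ∷ ns ]⇓ 0 →
          minᶠ f [ ns ]⇓ n

Recursiveℕ : ∀ {k} → Pred (Vec ℕ k) 0ℓ → Set
Recursiveℕ {k} A =
  Σ[ χ ∈ Partial k ] ∀ ns →
    (ns ∈ A × χ [ ns ]⇓ 1) ⊎ (¬ (ns ∈ A) × χ [ ns ]⇓ 0)

-- Recursively enumerable: the domain of a partial recursive function.
REℕ : ∀ {k} → Pred (Vec ℕ k) 0ℓ → Set
REℕ {k} A = Σ[ f ∈ Partial k ] ∀ ns → (ns ∈ A) ⇔ (∃[ m ] f [ ns ]⇓ m)

------------------------------------------------------------------------
-- Subsets of A ^ k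

-- Rings carry a setoid equality, so a subset has to respect it.  A subset
-- of A itself is a Subset A 1.

record Subset (A : Setoid 0ℓ 0ℓ) (k : ℕ) : Set₁ where
  open Setoid A using (Carrier; _≈_)
  field
    member   : Pred (Vec Carrier k) 0ℓ
    respects : ∀ {xs ys} → Pointwise _≈_ xs ys → xs ∈ member → ys ∈ member

open Subset public

full : ∀ {A k} → Subset A k
full .member _ = ⊤
full .respects _ _ = tt

-- The coordinatewise image.
image : ∀ {A B k} → Func A B → Subset A k → Subset B k
image {A} {B} d S .member ys =
  ∃[ xs ] xs ∈ member S × Pointwise (Setoid._≈_ B) (map (Func.to d) xs) ys
image {A} {B} d S .respects ys≈zs (xs , xs∈S , dxs≈ys) =
  xs , xs∈S , Pw.trans (Setoid.trans B) dxs≈ys ys≈zs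

------------------------------------------------------------------------
-- Computability transported along an injection into ℕ

module Represented {A : Setoid 0ℓ 0ℓ} (j : Injection A (setoid ℕ)) where
  open Setoid A using (Carrier)
  open Injection j using (to)

  codes : ∀ {k} → Subset A k → Pred (Vec ℕ k) 0ℓ
  codes S ns = ∃[ xs ] xs ∈ member S × map to xs ≡ ns

  RecursiveSubset : ∀ {k} → Subset A k → Set
  RecursiveSubset S = Recursiveℕ (codes S)

  RESubset : ∀ {k} → Subset A k → Set
  RESubset S = REℕ (codes S)

  -- Nothing is required of the algorithm outside the image of j; when that
  -- image is recursive, asking for a total recursive function on ℕ instead
  -- would give the same notion.
  RecursiveFunction : ∀ {k} → (Vec Carrier k → Carrier) → Set
  RecursiveFunction {k} f =
    Σ[ c ∈ Partial k ] ∀ xs → c [ map to xs ]⇓ to (f xs)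

------------------------------------------------------------------------
-- Recursive rings

onPair : ∀ {X : Set} → (X → X → X) → Vec X 2 → X
onPair _∙_ (x ∷ y ∷ []) = x ∙ y

-- Rings are not assumed commutative.  Since a recursive ring is countable,
-- nothing is lost by taking carriers at level 0.

record RecursiveRing : Set₁ where
  field
    ring : Ring 0ℓ 0ℓ
  open Ring ring public renaming (_+_ to _+ᴿ_; _*_ to _*ᴿ_; setoid to carrierSetoid)
  field
    representation : Injection carrierSetoid (setoid ℕ)
  open Represented representation public
  field
    image-recursive : RecursiveSubset (full {carrierSetoid} {1})
    +-recursive     : RecursiveFunction (onPair _+ᴿ_)
    *-recursive     : RecursiveFunction (onPair _*ᴿ_)

------------------------------------------------------------------------
-- Languages and their interpretations

record Language : Set₁ where
  field
    Constant : Set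
    Function : ℕ → Set
    Relation : ℕ → Set
    zeroᶜ    : Constant
    equalʳ   : Relation 2

record Interpretation (R : RecursiveRing) (L : Language) : Set₁ where
  open RecursiveRing R using (Carrier; _≈_; 0#; carrierSetoid)
  open Language L
  field
    constant      : Constant → Carrier
    function      : ∀ {k} → Function k → Vec Carrier k → Carrier
    function-cong : ∀ {k} (f : Function k) {xs ys} →
                    Pointwise _≈_ xs ys → function f xs ≈ function f ys
    relation      : ∀ {k} → Relation k → Subset carrierSetoid k
    zeroᶜ-is-0    : constant zeroᶜ ≈ 0#
    equalʳ-is-≈   : ∀ x y → ((x ∷ y ∷ []) ∈ member (relation equalʳ)) ⇔ (x ≈ y)

record RecursiveInterpretation (R : RecursiveRing) (L : Language) : Set₁ where
  open RecursiveRing R using (RecursiveFunction; RecursiveSubset)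
  open Language L
  field
    interpretation : Interpretation R L
  open Interpretation interpretation public
  field
    function-recursive : ∀ {k} (f : Function k) → RecursiveFunction (function f)
    relation-recursive : ∀ {k} (r : Relation k) → RecursiveSubset (relation r)

module _ (L : Language) where
  open Language L

  data Term (n : ℕ) : Set where
    var   : Fin n → Term n
    const : Constant → Term n
    app   : ∀ {k} → Function k → Vec (Term n) k → Term n

  data BasicFormula (n : ℕ) : Set where
    atom : ∀ {k} → Relation k → Vec (Term n) k → BasicFormula n

module _ {R : RecursiveRing} {L : Language} (I : RecursiveInterpretation R L) where
  open RecursiveRing R using (Carrier; carrierSetoid; RESubset)
  open RecursiveInterpretation I

  eval  : ∀ {n} → Vec Carrier n → Term L n → Carrier
  evals : ∀ {n k} → Vec Carrier n → Vec (Term L n) k → Vec Carrier k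
  eval ρ (var i)    = lookup ρ i
  eval ρ (const c)  = constant c
  eval ρ (app f ts) = function f (evals ρ ts)
  evals ρ []       = []
  evals ρ (t ∷ ts) = eval ρ t ∷ evals ρ ts

  Holds : ∀ {n} → Vec Carrier n → BasicFormula L n → Set
  Holds ρ (atom r ts) = evals ρ ts ∈ member (relation r)

  Diophantine : ∀ {k} → Subset carrierSetoid k → Set
  Diophantine {k} S =
    Σ[ l ∈ ℕ ] Σ[ fs ∈ List (BasicFormula L (k + l)) ]
      ∀ xs → (xs ∈ member S) ⇔ (Σ[ ys ∈ Vec Carrier l ] All (Holds (xs ++ ys)) fs)

  MRDP : Set₁
  MRDP = (S : Subset carrierSetoid 1) → RESubset S → Diophantine S

------------------------------------------------------------------------
-- Maps between recursive rings

Map : RecursiveRing → RecursiveRing → Set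
Map R₁ R₂ = Func (RecursiveRing.carrierSetoid R₁) (RecursiveRing.carrierSetoid R₂)

DiophantineMap : ∀ {R₁ R₂ L₁ L₂} →
                 RecursiveInterpretation R₁ L₁ → RecursiveInterpretation R₂ L₂ →
                 Map R₁ R₂ → Set₁
DiophantineMap {R₁} I₁ I₂ d =
  ∀ k (S : Subset (RecursiveRing.carrierSetoid R₁) k) →
  Diophantine I₁ S → Diophantine I₂ (image d S)

REPreserving : ∀ R₁ R₂ → Map R₁ R₂ → Set₁
REPreserving R₁ R₂ f =
  (S : Subset (RecursiveRing.carrierSetoid R₁) 1) →
  RecursiveRing.RESubset R₁ S → RecursiveRing.RESubset R₂ (image f S)

{-# OPTIONS --safe #-}
module Submission where

-- By MRDP a recursively enumerable S ⊆ R₁ is Diophantine, so its image d(S)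
-- is Diophantine in R₂.  It remains to see that a Diophantine subset of a
-- recursive ring with a recursive interpretation is recursively enumerable
-- (diophantine⇒re).
--
-- So let S = { xs | ∃ ys . φ (xs, ys) } with φ a conjunction of basic
-- formulas.  Terms evaluate recursively and relations are recursive, hence φ
-- is recursive on codes of tuples of ring elements (formulas-recursive).
-- The algorithms for the functions promise nothing outside the image of the
-- representation, so arbitrary numbers are first decoded: a number in the
-- image goes to the element it codes, any other number to 0#.  Decoding
-- followed by encoding is a total recursive function (recode⇓), because the
-- image is recursive.  A vector ns therefore codes an element of S iff all its
-- entries lie in the image and some ys : ℕ ^ l makes φ true at the decoding
-- of (ns, ys).  This is a recursive condition preceded by existential
-- quantifiers over ℕ, which can be merged into one
-- (semirecursive-∃, semirecursive-∃s) and searched by minimisation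
-- (semirecursive⇒re).
--
-- Merging needs no pairing function: ∃ y ∃ w . G w y holds iff
-- ∃ b ∃ y < b ∃ w < b . G w y does, and a bounded search for a zero of a
-- recursive function is a recursive product.

open import Defs

open import Data.Fin.Base using (Fin; zero; suc; _↑ˡ_; _↑ʳ_)
open import Data.List.Base using (List; []; _∷_; allFin)
open import Data.List.Membership.Propositional.Properties using (∈-allFin)
open import Data.List.Relation.Unary.All as All using (All; []; _∷_)
open import Data.Nat.Base using (ℕ; zero; suc; _+_; _*_; _<_; _⊔_; s≤s; z<s; s<s)
open import Data.Nat.Properties
  using (<-cmp; m+n≡0⇒m≡0; m+n≡0⇒n≡0; m*n≡0⇒m≡0∨n≡0; *-zeroʳ;
         m<1+n⇒m<n∨m≡n; m<n⇒m<1+n; n<1+n; m≤m⊔n; m≤n⊔m)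
open import Data.Product.Base using (Σ-syntax; ∃-syntax; _×_; _,_; proj₁; proj₂; uncurry)
open import Data.Sum.Base using (inj₁; inj₂)
open import Data.Unit.Base using (tt)
open import Data.Vec.Base using (Vec; []; _∷_; map; lookup; tabulate; _++_)
open import Data.Vec.Properties
  using (lookup-map; map-++; map-∘; lookup-++ˡ; lookup-++ʳ; tabulate∘lookup;
         ∷-injectiveˡ; ∷-injectiveʳ)
open import Data.Vec.Relation.Binary.Pointwise.Inductive as Pw using (Pointwise; []; _∷_)
open import Function.Base using (_∘_; id)
open import Function.Bundles using (Injection; Equivalence; _⇔_; mk⇔)
open import Relation.Binary.Definitions using (tri<; tri≈; tri>)
open import Relation.Binary.PropositionalEquality
  using (_≡_; refl; sym; trans; cong; cong₂; subst)
open import Relation.Nullary.Negation using (contradiction)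

open Equivalence using (to; from)

-- Evaluation of partial recursive functions

-- The relational semantics does define partial functions.
⇓-deterministic : ∀ {k} {f : Partial k} {ns a b} →
                  f [ ns ]⇓ a → f [ ns ]⇓ b → a ≡ b
⇓s-deterministic : ∀ {k m} {gs : Vec (Partial k) m} {ns} {as bs : Vec ℕ m} →
                   Pointwise (λ g v → g [ ns ]⇓ v) gs as →
                   Pointwise (λ g v → g [ ns ]⇓ v) gs bs → as ≡ bs
⇓-deterministic zero⇓ zero⇓ = refl
⇓-deterministic suc⇓ suc⇓ = refl
⇓-deterministic proj⇓ proj⇓ = refl
⇓-deterministic (comp⇓ gs⇓ f⇓) (comp⇓ gs⇓′ f⇓′)
  with refl ← ⇓s-deterministic gs⇓ gs⇓′ = ⇓-deterministic f⇓ f⇓′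
⇓-deterministic (precZ⇓ f⇓) (precZ⇓ f⇓′) = ⇓-deterministic f⇓ f⇓′
⇓-deterministic (precS⇓ r⇓ g⇓) (precS⇓ r⇓′ g⇓′)
  with refl ← ⇓-deterministic r⇓ r⇓′ = ⇓-deterministic g⇓ g⇓′
⇓-deterministic (min⇓ {n = n} below at) (min⇓ {n = n′} below′ at′) with <-cmp n n′
... | tri≈ _ n≡n′ _ = n≡n′
... | tri< n<n′ _ _ with () ← ⇓-deterministic at (proj₂ (below′ n n<n′))
... | tri> _ _ n′<n with () ← ⇓-deterministic (proj₂ (below n′ n′<n)) at′
⇓s-deterministic [] [] = refl
⇓s-deterministic (g⇓ ∷ gs⇓) (g⇓′ ∷ gs⇓′) =
  cong₂ _∷_ (⇓-deterministic g⇓ g⇓′) (⇓s-deterministic gs⇓ gs⇓′)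

-- The constant function n, in any arity.
numeralᶠ : ∀ {k} → ℕ → Partial k
numeralᶠ zero    = zeroᶠ
numeralᶠ (suc n) = compᶠ sucᶠ (numeralᶠ n ∷ [])

numeral⇓ : ∀ {k} {ns : Vec ℕ k} n → numeralᶠ n [ ns ]⇓ n
numeral⇓ zero    = zero⇓
numeral⇓ (suc n) = comp⇓ (numeral⇓ n ∷ []) suc⇓

plusᶠ : Partial 2
plusᶠ = precᶠ (projᶠ zero) (compᶠ sucᶠ (projᶠ (suc zero) ∷ []))

plus⇓ : ∀ m n → plusᶠ [ m ∷ n ∷ [] ]⇓ (m + n)
plus⇓ zero    n = precZ⇓ proj⇓
plus⇓ (suc m) n = precS⇓ (plus⇓ m n) (comp⇓ (proj⇓ ∷ []) suc⇓)

timesᶠ : Partial 2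
timesᶠ = precᶠ zeroᶠ (compᶠ plusᶠ (projᶠ (suc (suc zero)) ∷ projᶠ (suc zero) ∷ []))

times⇓ : ∀ m n → timesᶠ [ m ∷ n ∷ [] ]⇓ (m * n)
times⇓ zero    n = precZ⇓ zero⇓
times⇓ (suc m) n = precS⇓ (times⇓ m n) (comp⇓ (proj⇓ ∷ proj⇓ ∷ []) (plus⇓ n (m * n)))

projections⇓ : ∀ {k m} (σ : Fin m → Fin k) {ns ms} →
               (∀ i → lookup ns (σ i) ≡ lookup ms i) →
               Pointwise (λ g v → g [ ns ]⇓ v) (tabulate (projᶠ ∘ σ)) ms
projections⇓ σ {ns} {ms} eq =
  subst (Pointwise _ _) (tabulate∘lookup ms)
    (Pw.tabulate⁺ (λ i → subst (projᶠ (σ i) [ ns ]⇓_) (eq i) proj⇓))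

-- Computability relative to an encoding

-- An encoding e : X → ℕ ^ k need be neither injective nor surjective.  A
-- function is computable along e if some algorithm computes it correctly on
-- the codes e x; elsewhere the algorithm may diverge.  A ring operation f is
-- a RecursiveFunction iff the code of its value is computable along the code
-- map of the representation.

Computable : ∀ {X : Set} {k} → (X → Vec ℕ k) → (X → ℕ) → Set
Computable {k = k} e F = Σ[ c ∈ Partial k ] ∀ x → c [ e x ]⇓ F x

-- Componentwise computability of a vector-valued function.
Computables : ∀ {X : Set} {k m} → (X → Vec ℕ k) → (X → Vec ℕ m) → Set
Computables {k = k} {m} e h =
  Σ[ cs ∈ Vec (Partial k) m ] ∀ x → Pointwise (λ c v → c [ e x ]⇓ v) cs (h x)

module _ {X : Set} {k} {e : X → Vec ℕ k} where

  compose : ∀ {Y : Set} {m} {e′ : Y → Vec ℕ m} {h : X → Y} {F} →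
            Computables e (e′ ∘ h) → Computable e′ F → Computable e (F ∘ h)
  compose {h = h} (gs , gs⇓) (c , c⇓) = compᶠ c gs , λ x → comp⇓ (gs⇓ x) (c⇓ (h x))

  constant-computable : ∀ n → Computable e (λ _ → n)
  constant-computable n = numeralᶠ n , λ _ → numeral⇓ n

  +-computable : ∀ {F G} → Computable e F → Computable e G →
                 Computable e (λ x → F x + G x)
  +-computable (c , c⇓) (d , d⇓) =
    compᶠ plusᶠ (c ∷ d ∷ []) , λ x → comp⇓ (c⇓ x ∷ d⇓ x ∷ []) (plus⇓ _ _)

  reindexing : ∀ {m} {h : X → Vec ℕ m} (σ : Fin m → Fin k) →
               (∀ x i → lookup (e x) (σ i) ≡ lookup (h x) i) → Computables e h
  reindexing σ eq = tabulate (projᶠ ∘ σ) , λ x → projections⇓ σ (eq x)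

  ++-computable : ∀ {m n} {g : X → Vec ℕ m} {h : X → Vec ℕ n} →
                  Computables e g → Computables e h →
                  Computables e (λ x → g x ++ h x)
  ++-computable (cs , cs⇓) (ds , ds⇓) = cs ++ ds , λ x → Pw.++⁺ (cs⇓ x) (ds⇓ x)

  map-computable : ∀ {m} {f : ℕ → ℕ} {c : Partial 1} → (∀ n → c [ n ∷ [] ]⇓ f n) →
                   {h : X → Vec ℕ m} → Computables e h → Computables e (map f ∘ h)
  map-computable {c = c} c⇓ (gs , gs⇓) =
    map (λ g → compᶠ c (g ∷ [])) gs ,
    λ x → Pw.map⁺ (λ g⇓ → comp⇓ (g⇓ ∷ []) (c⇓ _)) (gs⇓ x)

-- Codes of (n , x), respectively (ns , x), in front of a code of x.

cons : ∀ {X : Set} {k} → (X → Vec ℕ k) → ℕ × X → Vec ℕ (suc k)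
cons e (n , x) = n ∷ e x

append : ∀ {X : Set} {k} l → (X → Vec ℕ k) → Vec ℕ l × X → Vec ℕ (l + k)
append l e (ns , x) = ns ++ e x

-- Recursive predicates

-- A predicate is recursive along e if it is the zero set of a function
-- computable along e.

Recursive : ∀ {X : Set} {k} → (X → Vec ℕ k) → (X → Set) → Set
Recursive {X} e P =
  Σ[ F ∈ (X → ℕ) ] Computable e F × (∀ x → P x ⇔ F x ≡ 0)

module _ {X : Set} {k} {e : X → Vec ℕ k} where

  recursive-∘ : ∀ {Y : Set} {m} {e′ : Y → Vec ℕ m} {P : Y → Set} {h : X → Y} →
                Computables e (e′ ∘ h) → Recursive e′ P → Recursive e (P ∘ h)
  recursive-∘ {e′ = e′} {h = h} h-comp (F , F-comp , spec) =
    F ∘ h , compose {e′ = e′} {h = h} h-comp F-comp , spec ∘ h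

  recursive-⇔ : ∀ {P Q : X → Set} → (∀ x → Q x → P x) → (∀ x → P x → Q x) →
                Recursive e P → Recursive e Q
  recursive-⇔ Q⇒P P⇒Q (F , F-comp , spec) =
    F , F-comp , λ x → mk⇔ (to (spec x) ∘ Q⇒P x) (P⇒Q x ∘ from (spec x))

  recursive-× : ∀ {P Q : X → Set} → Recursive e P → Recursive e Q →
                Recursive e (λ x → P x × Q x)
  recursive-× (F , F-comp , F-spec) (G , G-comp , G-spec) =
    (λ x → F x + G x) , +-computable F-comp G-comp ,
    λ x → mk⇔
      (λ { (p , q) → cong₂ _+_ (to (F-spec x) p) (to (G-spec x) q) })
      (λ F+G≡0 → from (F-spec x) (m+n≡0⇒m≡0 (F x) F+G≡0) ,
                 from (G-spec x) (m+n≡0⇒n≡0 (F x) F+G≡0))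

  recursive-All : ∀ {A : Set} {P : A → X → Set} → (∀ a → Recursive e (P a)) →
                  ∀ as → Recursive e (λ x → All (λ a → P a x) as)
  recursive-All P-rec []       =
    (λ _ → 0) , constant-computable 0 , λ _ → mk⇔ (λ _ → refl) (λ _ → [])
  recursive-All P-rec (a ∷ as) =
    recursive-⇔ (λ _ ps → All.head ps , All.tail ps) (λ { _ (p , ps) → p ∷ ps })
      (recursive-× (P-rec a) (recursive-All P-rec as))

  -- An algorithm sees nothing of x but its code.
  recursive-respects-code : ∀ {P : X → Set} → Recursive e P →
                            ∀ {x y} → e x ≡ e y → P x → P y
  recursive-respects-code (F , (c , c⇓) , spec) {x} {y} ex≡ey px =
    from (spec y) (trans (sym Fx≡Fy) (to (spec x) px))
    where
    Fx≡Fy : F x ≡ F y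
    Fx≡Fy = ⇓-deterministic (subst (c [_]⇓ F x) ex≡ey (c⇓ x)) (c⇓ y)

-- Recursiveness in terms of a characteristic function implies the zero-set
-- form.  Here χ takes the value 1 on A; the zero set of 1 ∸ χ is wanted.
recursiveℕ⇒recursive : ∀ {k} {A : Vec ℕ k → Set} → Recursiveℕ A → Recursive id A
recursiveℕ⇒recursive {k} {A} (χ , χ-spec) =
  F , (compᶠ flipᶠ (χ ∷ []) , F⇓) , F-spec
  where
  flipᶠ : Partial 1
  flipᶠ = precᶠ (numeralᶠ 1) zeroᶠ

  F : Vec ℕ k → ℕ
  F ns with χ-spec ns
  ... | inj₁ _ = 0
  ... | inj₂ _ = 1

  F⇓ : ∀ ns → compᶠ flipᶠ (χ ∷ []) [ ns ]⇓ F ns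
  F⇓ ns with χ-spec ns
  ... | inj₁ (_ , χ⇓1) = comp⇓ (χ⇓1 ∷ []) (precS⇓ (precZ⇓ (numeral⇓ 1)) zero⇓)
  ... | inj₂ (_ , χ⇓0) = comp⇓ (χ⇓0 ∷ []) (precZ⇓ (numeral⇓ 1))

  F-spec : ∀ ns → A ns ⇔ F ns ≡ 0
  F-spec ns with χ-spec ns
  ... | inj₁ (ns∈A , _) = mk⇔ (λ _ → refl) (λ _ → ns∈A)
  ... | inj₂ (ns∉A , _) = mk⇔ (λ ns∈A → contradiction ns∈A ns∉A) (λ ())

-- Bounded search

-- The product of f 0, ..., f (b - 1): it vanishes iff f has a zero below b.
productBelow : (ℕ → ℕ) → ℕ → ℕ
productBelow f zero    = 1
productBelow f (suc b) = productBelow f b * f b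

productBelow≡0⇒ : ∀ f b → productBelow f b ≡ 0 → ∃[ n ] n < b × f n ≡ 0
productBelow≡0⇒ f (suc b) eq with m*n≡0⇒m≡0∨n≡0 (productBelow f b) eq
... | inj₂ fb≡0   = b , n<1+n b , fb≡0
... | inj₁ rest≡0 =
  let n , n<b , fn≡0 = productBelow≡0⇒ f b rest≡0 in n , m<n⇒m<1+n n<b , fn≡0

productBelow≡0⇐ : ∀ f b {n} → n < b → f n ≡ 0 → productBelow f b ≡ 0
productBelow≡0⇐ f (suc b) n<1+b fn≡0 with m<1+n⇒m<n∨m≡n n<1+b
... | inj₁ n<b  = cong (_* f b) (productBelow≡0⇐ f b n<b fn≡0)
... | inj₂ refl = trans (cong (productBelow f b *_) fn≡0) (*-zeroʳ (productBelow f b))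

recursive-∃< : ∀ {X : Set} {k} {e : X → Vec ℕ k} {P : ℕ × X → Set} →
               Recursive (cons e) P →
               Recursive (cons e) (λ (b , x) → ∃[ n ] n < b × P (n , x))
recursive-∃< {X} {k} {e} (F , (c , c⇓) , spec) =
  (λ (b , x) → productBelow (λ n → F (n , x)) b) ,
  (searchᶠ , uncurry search⇓) ,
  λ (b , x) → mk⇔
    (λ (n , n<b , p) → productBelow≡0⇐ _ b n<b (to (spec (n , x)) p))
    (λ eq → let n , n<b , Fn≡0 = productBelow≡0⇒ _ b eq
            in n , n<b , from (spec (n , x)) Fn≡0)
  where
  -- The recursion step is given the counter, the product so far and e x.
  factorᶠ : Partial (2 + k)
  factorᶠ = compᶠ c (projᶠ zero ∷ tabulate (projᶠ ∘ (2 ↑ʳ_)))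

  searchᶠ : Partial (1 + k)
  searchᶠ = precᶠ (numeralᶠ 1) (compᶠ timesᶠ (projᶠ (suc zero) ∷ factorᶠ ∷ []))

  search⇓ : ∀ b x → searchᶠ [ b ∷ e x ]⇓ productBelow (λ n → F (n , x)) b
  search⇓ zero    x = precZ⇓ (numeral⇓ 1)
  search⇓ (suc b) x =
    precS⇓ (search⇓ b x)
      (comp⇓ (proj⇓ ∷ comp⇓ (proj⇓ ∷ projections⇓ (2 ↑ʳ_) (λ _ → refl)) (c⇓ (b , x)) ∷ [])
             (times⇓ _ _))

-- Semirecursive predicates

-- A semirecursive predicate is a recursive one preceded by a single
-- existential quantifier over ℕ.

Semirecursive : ∀ {X : Set} {k} → (X → Vec ℕ k) → (X → Set) → Set₁
Semirecursive {X} e P =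
  Σ[ Q ∈ (ℕ × X → Set) ] Recursive (cons e) Q × (∀ x → P x ⇔ (∃[ w ] Q (w , x)))

recursive⇒semirecursive : ∀ {X : Set} {k} {e : X → Vec ℕ k} {P} →
                          Recursive e P → Semirecursive e P
recursive⇒semirecursive {e = e} {P} P-rec =
  P ∘ proj₂ ,
  recursive-∘ {e′ = e} {h = proj₂} (reindexing suc (λ _ _ → refl)) P-rec ,
  λ x → mk⇔ (0 ,_) proj₂

semirecursive-∃ : ∀ {X : Set} {k} {e : X → Vec ℕ k} {P : ℕ × X → Set} →
                  Semirecursive (cons e) P → Semirecursive e (λ x → ∃[ n ] P (n , x))
semirecursive-∃ {X} {k} {e} {P} (Q , Q-rec , P⇔∃Q) =
  Bounded , bounded-rec , λ x → mk⇔ (bound x) (unbound x)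
  where
  -- One bound b serves both quantifiers.
  Bounded : ℕ × X → Set
  Bounded (b , x) = ∃[ n ] n < b × (∃[ w ] w < b × Q (w , n , x))

  swap : Fin (2 + k) → Fin (2 + k)
  swap zero          = suc zero
  swap (suc zero)    = zero
  swap (suc (suc i)) = suc (suc i)

  -- The bounds c and b of the two searches are separate arguments until both
  -- have been performed.
  inner : Recursive (cons (cons e)) (λ (n , b , x) → ∃[ w ] w < b × Q (w , n , x))
  inner = recursive-∘ {e′ = cons (cons e)} {h = λ (n , b , x) → b , n , x}
    (reindexing swap λ { _ zero → refl ; _ (suc zero) → refl ; _ (suc (suc i)) → refl })
    (recursive-∃< Q-rec)

  bounded-rec : Recursive (cons e) Bounded
  bounded-rec = recursive-∘ {e′ = cons (cons e)} {h = λ (b , x) → b , b , x}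
    (reindexing diagonal λ { _ zero → refl ; _ (suc zero) → refl ; _ (suc (suc i)) → refl })
    (recursive-∃< inner)
    where
    diagonal : Fin (2 + k) → Fin (1 + k)
    diagonal zero    = zero
    diagonal (suc i) = i

  bound : ∀ x → ∃[ n ] P (n , x) → ∃[ b ] Bounded (b , x)
  bound x (n , p) =
    let w , q = to (P⇔∃Q (n , x)) p
    in suc (n ⊔ w) , n , s≤s (m≤m⊔n n w) , w , s≤s (m≤n⊔m n w) , q

  unbound : ∀ x → ∃[ b ] Bounded (b , x) → ∃[ n ] P (n , x)
  unbound x (_ , n , _ , w , _ , q) = n , from (P⇔∃Q (n , x)) (w , q)

semirecursive-∃s : ∀ {X : Set} {k} {e : X → Vec ℕ k} l {P : Vec ℕ l × X → Set} →
                   Semirecursive (append l e) P →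
                   Semirecursive e (λ x → ∃[ ns ] P (ns , x))
semirecursive-∃s zero (Q , Q-rec , P⇔∃Q) =
  (λ (w , x) → Q (w , [] , x)) ,
  recursive-∘ {h = λ (w , x) → w , [] , x} (reindexing id (λ _ _ → refl)) Q-rec ,
  λ x → mk⇔ (λ { ([] , p) → to (P⇔∃Q ([] , x)) p })
            (λ wq → [] , from (P⇔∃Q ([] , x)) wq)
semirecursive-∃s {X} {e = e} (suc l) {P} (Q , Q-rec , P⇔∃Q) =
  let Q′ , Q′-rec , ∃P⇔∃Q′ = semirecursive-∃s {e = e} l (semirecursive-∃ unconsed) in
  Q′ , Q′-rec ,
  λ x → mk⇔ (λ { (n ∷ ns , p) → to (∃P⇔∃Q′ x) (ns , n , p) })
            (λ wq → let ns , n , p = from (∃P⇔∃Q′ x) wq in n ∷ ns , p)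
  where
  unconsed : Semirecursive (cons (append l e)) (λ (n , ns , x) → P (n ∷ ns , x))
  unconsed =
    (λ (w , n , ns , x) → Q (w , n ∷ ns , x)) ,
    recursive-∘ {h = λ (w , n , ns , x) → w , n ∷ ns , x} (reindexing id (λ _ _ → refl)) Q-rec ,
    λ (n , ns , x) → P⇔∃Q (n ∷ ns , x)

-- The derivation of a minimisation requires the values before the zero found
-- to be explicit successors.
least-zero : ∀ (f : ℕ → ℕ) w → f w ≡ 0 →
             ∃[ n ] f n ≡ 0 × (∀ m → m < n → ∃[ q ] f m ≡ suc q)
least-zero f w fw≡0 with f 0 in f0≡
least-zero f w       fw≡0 | zero  = 0 , f0≡ , λ _ ()
least-zero f zero    fw≡0 | suc q with () ← trans (sym f0≡) fw≡0
least-zero f (suc w) fw≡0 | suc q =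
  let n , fn≡0 , below = least-zero (f ∘ suc) w fw≡0 in
  suc n , fn≡0 , λ { zero    z<s       → q , f0≡
                   ; (suc m) (s<s m<n) → below m m<n }

semirecursive⇒re : ∀ {k} {P : Vec ℕ k → Set} → Semirecursive id P → REℕ P
semirecursive⇒re {P = P} (Q , (F , (c , c⇓) , Q⇔F≡0) , P⇔∃Q) =
  minᶠ c , λ ns → mk⇔ (halts ns) (sound ns)
  where
  halts : ∀ ns → P ns → ∃[ n ] minᶠ c [ ns ]⇓ n
  halts ns p =
    let w , q           = to (P⇔∃Q ns) p
        n , Fn≡0 , below = least-zero (λ w → F (w , ns)) w (to (Q⇔F≡0 (w , ns)) q)
    in n , min⇓ (λ m m<n → let q , Fm≡ = below m m<n in
                           q , subst (c [ m ∷ ns ]⇓_) Fm≡ (c⇓ (m , ns)))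
                (subst (c [ n ∷ ns ]⇓_) Fn≡0 (c⇓ (n , ns)))

  sound : ∀ ns → ∃[ n ] minᶠ c [ ns ]⇓ n → P ns
  sound ns (n , min⇓ _ c⇓0) =
    from (P⇔∃Q ns) (n , from (Q⇔F≡0 (n , ns)) (⇓-deterministic (c⇓ (n , ns)) c⇓0))

-- Decoding in a recursive ring

module Decoding (R : RecursiveRing) where
  open RecursiveRing R using (Carrier; 0#; image-recursive; representation;
                              carrierSetoid; codes; RecursiveSubset)
  open Injection representation using (injective) renaming (to to code)

  InImage : ℕ → Set
  InImage n = codes (full {carrierSetoid} {1}) (n ∷ [])

  -- Numbers outside the image decode to 0#.
  decode : ℕ → Carrier
  decode n with proj₂ image-recursive (n ∷ [])
  ... | inj₁ ((x ∷ [] , _) , _) = x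
  ... | inj₂ _                  = 0#

  code-decode : ∀ {n} → InImage n → code (decode n) ≡ n
  code-decode {n} n∈im with proj₂ image-recursive (n ∷ [])
  ... | inj₁ ((x ∷ [] , _ , eq) , _) = ∷-injectiveˡ eq
  ... | inj₂ (n∉im , _)              = contradiction n∈im n∉im

  code-inImage : ∀ x → InImage (code x)
  code-inImage x = x ∷ [] , tt , refl

  map-code-decode : ∀ {k} (ns : Vec ℕ k) → (∀ i → InImage (lookup ns i)) →
                    map code (map decode ns) ≡ ns
  map-code-decode []       _    = refl
  map-code-decode (n ∷ ns) n∈im =
    cong₂ _∷_ (code-decode (n∈im zero)) (map-code-decode ns (n∈im ∘ suc))

  recodeᶠ : Partial 1
  recodeᶠ =
    compᶠ (precᶠ (numeralᶠ (code 0#)) (projᶠ (suc (suc zero))))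
          (proj₁ image-recursive ∷ projᶠ zero ∷ [])

  -- The characteristic value of the image drives a recursion of length 0 or
  -- 1, which acts as a case distinction.
  recode⇓ : ∀ n → recodeᶠ [ n ∷ [] ]⇓ code (decode n)
  recode⇓ n with proj₂ image-recursive (n ∷ [])
  ... | inj₁ ((x ∷ [] , _ , eq) , χ⇓1) rewrite ∷-injectiveˡ eq =
    comp⇓ (χ⇓1 ∷ proj⇓ ∷ []) (precS⇓ (precZ⇓ (numeral⇓ _)) proj⇓)
  ... | inj₂ (_ , χ⇓0) =
    comp⇓ (χ⇓0 ∷ proj⇓ ∷ []) (precZ⇓ (numeral⇓ _))

  decode-computable : ∀ {X : Set} {k m} {e : X → Vec ℕ k} {h : X → Vec ℕ m} →
                      Computables e h → Computables e (map code ∘ map decode ∘ h)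
  decode-computable {h = h} h-comp =
    let cs , cs⇓ = map-computable recode⇓ h-comp
    in cs , λ x → subst (Pointwise _ cs) (map-∘ code decode (h x)) (cs⇓ x)

  allInImage-recursive : ∀ {X : Set} {k m} {e : X → Vec ℕ k} {h : X → Vec ℕ m} →
                         Computables e h →
                         Recursive e (λ x → ∀ i → InImage (lookup (h x) i))
  allInImage-recursive {m = m} {h = h} (cs , cs⇓) =
    recursive-⇔ (λ _ all → All.tabulate (λ {i} _ → all i))
                (λ _ all i → All.lookup all (∈-allFin i))
      (recursive-All
        (λ i → recursive-∘ {e′ = id} {h = λ x → lookup (h x) i ∷ []}
          (lookup cs i ∷ [] , λ x → Pw.lookup (cs⇓ x) i ∷ [])
          (recursiveℕ⇒recursive image-recursive))
        (allFin m))

  map-code-injective : ∀ {k} {xs ys : Vec Carrier k} → map code xs ≡ map code ys →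
                       Pointwise (RecursiveRing._≈_ R) xs ys
  map-code-injective {xs = []}     {[]}     _  = []
  map-code-injective {xs = x ∷ xs} {y ∷ ys} eq =
    injective (∷-injectiveˡ eq) ∷ map-code-injective (∷-injectiveʳ eq)

  -- Since subsets respect the ring equality, membership can be tested on
  -- codes.
  recursiveSubset⇒recursive : ∀ {k} (S : Subset carrierSetoid k) →
                              RecursiveSubset S → Recursive (map code) (member S)
  recursiveSubset⇒recursive S S-rec =
    recursive-⇔ (λ xs xs∈S → xs , xs∈S , refl)
                (λ { xs (ys , ys∈S , eq) → respects S (map-code-injective eq) ys∈S })
      (recursive-∘ {e′ = id} {h = map code} (reindexing id (λ _ _ → refl))
        (recursiveℕ⇒recursive S-rec))

-- Diophantine sets are recursively enumerable

module _ {R : RecursiveRing} {L : Language} (I : RecursiveInterpretation R L) where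
  open RecursiveRing R using (Carrier; carrierSetoid; representation; RESubset;
                              RecursiveFunction; codes)
  open Injection representation using () renaming (to to code)
  open RecursiveInterpretation I
  open Decoding R

  eval-recursive  : ∀ {n} (t : Term L n) → RecursiveFunction (λ ρ → eval I ρ t)
  evals-recursive : ∀ {n k} (ts : Vec (Term L n) k) →
                    Computables (map code) (λ ρ → map code (evals I ρ ts))
  eval-recursive (var i)    =
    projᶠ i , λ ρ → subst (projᶠ i [ map code ρ ]⇓_) (lookup-map i code ρ) proj⇓
  eval-recursive (const c)  = constant-computable (code (constant c))
  eval-recursive (app f ts) =
    compose {e′ = map code} {h = λ ρ → evals I ρ ts} {F = λ xs → code (function f xs)}
      (evals-recursive ts) (function-recursive f)
  evals-recursive []       = [] , λ _ → []
  evals-recursive (t ∷ ts) =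
    let c  , c⇓  = eval-recursive t
        cs , cs⇓ = evals-recursive ts
    in c ∷ cs , λ ρ → c⇓ ρ ∷ cs⇓ ρ

  formulas-recursive : ∀ {n} (fs : List (BasicFormula L n)) →
                       Recursive (map code) (λ ρ → All (Holds I ρ) fs)
  formulas-recursive = recursive-All λ where
    (atom r ts) → recursive-∘ {e′ = map code} {h = λ ρ → evals I ρ ts}
      (evals-recursive ts)
      (recursiveSubset⇒recursive (relation r) (relation-recursive r))

  diophantine⇒re : ∀ {k} (S : Subset carrierSetoid k) → Diophantine I S → RESubset S
  diophantine⇒re {k} S (l , fs , S⇔∃fs) =
    semirecursive⇒re (Q , Q-rec , λ ns → mk⇔ (to (∃⇔∃Q ns) ∘ decoded ns)
                                             (encoded ns ∘ from (∃⇔∃Q ns)))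
    where
    -- The quantified numbers ms precede ns in the encoding, so that they can be
    -- removed one by one from the front.
    P : Vec ℕ l × Vec ℕ k → Set
    P (ms , ns) = (∀ i → InImage (lookup ns i)) ×
                  All (Holds I (map decode (ns ++ ms))) fs

    variables : Computables (append l id) (λ ((ms , ns) : Vec ℕ l × Vec ℕ k) → ns)
    variables = reindexing (l ↑ʳ_) (λ (ms , ns) → lookup-++ʳ ms ns)

    witnesses : Computables (append l id) (λ ((ms , ns) : Vec ℕ l × Vec ℕ k) → ms)
    witnesses = reindexing (_↑ˡ k) (λ (ms , ns) → lookup-++ˡ ms ns)

    P-rec : Recursive (append l id) P
    P-rec = recursive-×
      (allInImage-recursive variables)
      (recursive-∘ {e′ = map code} {h = λ (ms , ns) → map decode (ns ++ ms)}
        (decode-computable (++-computable variables witnesses))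
        (formulas-recursive fs))

    ∃P : Semirecursive id (λ ns → ∃[ ms ] P (ms , ns))
    ∃P = semirecursive-∃s {e = id} l (recursive⇒semirecursive P-rec)

    Q     = proj₁ ∃P
    Q-rec = proj₁ (proj₂ ∃P)
    ∃⇔∃Q  = proj₂ (proj₂ ∃P)

    inImage : ∀ {m} (xs : Vec Carrier m) i → InImage (lookup (map code xs) i)
    inImage xs i = subst InImage (sym (lookup-map i code xs)) (code-inImage (lookup xs i))

    decoded : ∀ ns → codes S ns → ∃[ ms ] P (ms , ns)
    decoded _ (xs , xs∈S , refl) =
      let ys , holds = to (S⇔∃fs xs) xs∈S in
      map code ys , inImage xs ,
      recursive-respects-code (formulas-recursive fs) (same-code ys) holds
      where
      -- Decoding the codes of xs ++ ys gives this tuple back only up to the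
      -- ring equality, but with the same code.
      same-code : ∀ ys → map code (xs ++ ys) ≡
                         map code (map decode (map code xs ++ map code ys))
      same-code ys rewrite sym (map-++ code xs ys) =
        sym (map-code-decode (map code (xs ++ ys)) (inImage (xs ++ ys)))

    encoded : ∀ ns → ∃[ ms ] P (ms , ns) → codes S ns
    encoded ns (ms , ns∈im , holds) =
      map decode ns ,
      from (S⇔∃fs (map decode ns))
        (map decode ms , subst (λ ρ → All (Holds I ρ) fs) (map-++ decode ns ms) holds) ,
      map-code-decode ns ns∈im

lemma6p21 : (R₁ R₂ : RecursiveRing) (L₁ L₂ : Language)
    (I₁ : RecursiveInterpretation R₁ L₁)
    (I₂ : RecursiveInterpretation R₂ L₂) →
    MRDP I₁ →
    (d : Map R₁ R₂) → DiophantineMap I₁ I₂ d →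
    REPreserving R₁ R₂ d
lemma6p21 R₁ R₂ L₁ L₂ I₁ I₂ mrdp d d-dioph S S-re =
  diophantine⇒re I₂ (image d S) (d-dioph 1 S (mrdp S S-re))
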